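{- Let $\mathbf v$ be a complementary symmetric Rote sequence. Then every non-empty prefix $x$ of $\mathbf v$ has exactly three distinct return words in $\mathbf v$.
   Context: A complementary symmetric Rote sequence is a sequence $\mathbf v\in\{0,1\}^{\mathbb N}$ with factor complexity $\mathcal C(n)=2n$ for all $n\ge1$ (number of distinct factors of length $n$) whose set of factors is closed under the exchange of letters $0\leftrightarrow1$. For a prefix $x$ of a sequence $\mathbf v=v_0v_1\cdots$, if $i<j$ are two consecutive occurrences of $x$ in $\mathbf v$ (indices where $x$ starts), the word $v_iv_{i+1}\cdots v_{j-1}$ is a return word to $x$ in $\mathbf v$. -}

module Defs where

open import Data.Bool using (Bool; not)
open import Data.Nat using (ℕ; zero; suc; _+_; _*_; _<_; _≤_; _∸_)
open import Data.List using (List; []; _∷_; length; map; take; drop)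
open import Data.List.Membership.Propositional using (_∈_)
open import Data.List.Relation.Unary.Unique.Propositional using (Unique)
open import Data.Product using (Σ; _×_; ∃)
open import Relation.Binary.PropositionalEquality using (_≡_)
open import Relation.Nullary using (¬_)
open import Function.Bundles using (_⇔_)

Seq : Set
Seq = ℕ → Bool

Word : Set
Word = List Bool

slice : Seq → ℕ → ℕ → Word
slice v i zero    = []
slice v i (suc n) = v i ∷ slice v (suc i) n

OccursAt : Seq → Word → ℕ → Set
OccursAt v w i = slice v i (length w) ≡ w

Factor : Seq → Word → Set
Factor v w = ∃ λ i → OccursAt v w i

ComplexityIs : Seq → ℕ → ℕ → Set
ComplexityIs v n c =
  Σ (List Word) λ L →
    Unique L × length L ≡ c ×
    (∀ (w : Word) → (Factor v w × length w ≡ n) ⇔ (w ∈ L))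

complement : Word → Word
complement = map not

IsCSRote : Seq → Set
IsCSRote v =
  (∀ (n : ℕ) → 1 ≤ n → ComplexityIs v n (2 * n)) ×
  (∀ (w : Word) → Factor v w → Factor v (complement w))

prefix : Seq → ℕ → Word
prefix v n = slice v 0 n

IsReturnWord : Seq → Word → Word → Set
IsReturnWord v x r =
  ∃ λ i → ∃ λ j →
    i < j × OccursAt v x i × OccursAt v x j ×
    (∀ k → i < k → k < j → ¬ OccursAt v x k) ×
    r ≡ slice v i (j ∸ i)

ReturnWordCount : Seq → Word → ℕ → Set
ReturnWordCount v x c =
  Σ (List Word) λ L →
    Unique L × length L ≡ c ×
    (∀ (r : Word) → IsReturnWord v x r ⇔ (r ∈ L))

{-# OPTIONS --safe #-}

-- Since C(n + 1) − C(n) = 2, the right special factors of each length n ≥ 1 are a word and its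
-- complement, so they are the suffixes of two complementary left-growing branches. Consider the
-- tree of the words that start with the prefix x and contain x only there: its leaves are the
-- complete return words to x, and its binary branching points are the right special factors in
-- which x occurs exactly once, as a prefix. A long right special factor starting with a prefix
-- that contains both x and its complement shows that x occurs in both branches; cutting each
-- branch at its last occurrence of x gives exactly two branching points, hence three leaves.

module Submission where

open import Defs
open import Data.Nat using (ℕ; zero; suc; _≤_; _+_; _*_; _∸_; _<_; z≤n; s≤s; z<s; s<s; s≤s⁻¹; s<s⁻¹; _≟_)
open import Data.Nat.Properties
open import Data.Nat.Induction using (<-rec)
open import Data.Bool using (Bool; true; false; not; _xor_)
open import Data.Bool.Properties using (xor-assoc; xor-same; xor-identityʳ; not-¬; ¬-not; not-involutive)
  renaming (_≟_ to _≟ᵇ_)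
open import Data.List using (List; []; _∷_; _++_; _∷ʳ_; length; map; applyUpTo)
open import Data.List.Properties
  using (length-map; length-++; length-++-comm; length-applyUpTo; ∷-injective; ∷ʳ-injective; map-id; ≡-dec)
open import Data.List.Membership.Propositional using (_∈_)
open import Data.List.Membership.Propositional.Properties
  using (∈-∃++; ∈-++⁻; ∈-++⁺ˡ; ∈-++⁺ʳ; ∈-map⁻; ∈-applyUpTo⁺)
open import Data.List.Membership.DecPropositional (≡-dec _≟ᵇ_) using (_∈?_)
open import Data.List.Relation.Binary.Subset.Propositional using (_⊆_)
open import Data.List.Relation.Unary.All as All using (All; []; _∷_)
open import Data.List.Relation.Unary.AllPairs using ([]; _∷_)
open import Data.List.Relation.Unary.Any using (here; there)
open import Data.List.Relation.Unary.Unique.Propositional using (Unique)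
open import Data.List.Relation.Unary.Unique.Propositional.Properties using (map⁺; ++⁺)
open import Data.Product using (∃; ∃₂; _×_; _,_; proj₁; proj₂)
open import Data.Sum using (_⊎_; inj₁; inj₂)
open import Function using (_∘_)
open import Function.Bundles using (mk⇔; Equivalence)
open import Relation.Binary.Definitions using (tri<; tri≈; tri>)
open import Relation.Binary.PropositionalEquality
  using (_≡_; _≢_; refl; sym; trans; cong; cong₂; subst; subst₂)
open import Relation.Nullary using (¬_; Dec; yes; no; contradiction)
open import Relation.Unary using (Decidable)

open Equivalence using (to; from)

-- Finite lists, bounded search and Booleans.

unique-⊆⇒length-≤ : {A : Set} {xs ys : List A} → Unique xs → xs ⊆ ys → length xs ≤ length ys
unique-⊆⇒length-≤ {xs = []} _ _ = z≤n
unique-⊆⇒length-≤ {xs = x ∷ xs} (x∉xs ∷ uniq) sub with ∈-∃++ (sub (here refl))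
... | ys , zs , refl = begin
  suc (length xs)         ≤⟨ s≤s (unique-⊆⇒length-≤ uniq sub′) ⟩
  suc (length (ys ++ zs)) ≡⟨ cong suc (length-++-comm ys zs) ⟩
  length (x ∷ zs ++ ys)   ≡⟨ length-++-comm (x ∷ zs) ys ⟩
  length (ys ++ x ∷ zs)   ∎
  where
  open ≤-Reasoning
  sub′ : xs ⊆ ys ++ zs
  sub′ w∈xs with ∈-++⁻ ys (sub (there w∈xs))
  ... | inj₁ w∈ys         = ∈-++⁺ˡ w∈ys
  ... | inj₂ (here refl)  = contradiction refl (All.lookup x∉xs w∈xs)
  ... | inj₂ (there w∈zs) = ∈-++⁺ʳ ys w∈zs

-- Stands in for excluded middle: `A` is searched for over finitely many elements.
∀-⊎-distrib : {A X : Set} {Q : X → Set} {xs : List X} →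
              (∀ {x} → x ∈ xs → A ⊎ Q x) → A ⊎ All Q xs
∀-⊎-distrib {xs = []} f = inj₂ []
∀-⊎-distrib {xs = x ∷ xs} f with f (here refl) | ∀-⊎-distrib {xs = xs} (f ∘ there)
... | inj₁ a | _       = inj₁ a
... | inj₂ _ | inj₁ a  = inj₁ a
... | inj₂ q | inj₂ qs = inj₂ (q ∷ qs)

last-below : {P : ℕ → Set} → Decidable P → ∀ b {u} → u ≤ b → P u →
             ∃ λ m → m ≤ b × P m × (∀ {k} → m < k → k ≤ b → ¬ P k)
last-below P? b u≤b pu with P? b
... | yes pb = b , ≤-refl , pb , λ b<k k≤b → contradiction b<k (≤⇒≯ k≤b)
last-below P? zero z≤n pu | no ¬pb = contradiction pu ¬pb
last-below {P} P? (suc b) u≤b pu | no ¬pb with m≤n⇒m<n∨m≡n u≤b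
... | inj₂ refl = contradiction pu ¬pb
... | inj₁ u<1+b with last-below P? b (s≤s⁻¹ u<1+b) pu
...   | m , m≤b , pm , last = m , m≤n⇒m≤1+n m≤b , pm , last′
  where
  last′ : ∀ {k} → m < k → k ≤ suc b → ¬ P k
  last′ m<k k≤1+b with m≤n⇒m<n∨m≡n k≤1+b
  ... | inj₁ k<1+b = last m<k (s≤s⁻¹ k<1+b)
  ... | inj₂ refl  = ¬pb

least : {P : ℕ → Set} → Decidable P → ∀ b → P b → ∃ λ m → P m × (∀ {k} → k < m → ¬ P k)
least P? b pb with P? 0
... | yes p0 = 0 , p0 , λ ()
least P? zero pb | no ¬p0 = contradiction pb ¬p0
least {P} P? (suc b) pb | no ¬p0 with least (P? ∘ suc) b pb
... | m , pm , first = suc m , pm , first′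
  where
  first′ : ∀ {k} → k < suc m → ¬ P k
  first′ {zero}  _     = ¬p0
  first′ {suc k} k<1+m = first (s<s⁻¹ k<1+m)

xor-flip : ∀ s {x y} → x ≡ s xor y → y ≡ s xor x
xor-flip false eq = sym eq
xor-flip true {y = y} refl = sym (not-involutive y)

≢-≢⇒≡ : ∀ {x y z : Bool} → x ≢ y → z ≢ y → x ≡ z
≢-≢⇒≡ x≢y z≢y = trans (¬-not x≢y) (sym (¬-not z≢y))

-- Matching up to complement, and forks.

module _ (v : Seq) where

  private variable
    i j k l m n : ℕ
    s t : Bool

  -- `s = true` compares with the complement, `s = false` is plain agreement. Composing matches adds
  -- the signs by `xor`, so both kinds are treated together.
  record Match (s : Bool) (i j n : ℕ) : Set where
    constructor matching
    field at : ∀ {k} → k < n → v (i + k) ≡ s xor v (j + k)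

  open Match

  Agree : ℕ → ℕ → ℕ → Set
  Agree = Match false

  match-refl : Agree i i n
  match-refl = matching λ _ → refl

  match-sym : Match s i j n → Match s j i n
  match-sym {s} p = matching λ k<n → xor-flip s (at p k<n)

  match-trans : Match s i j n → Match t j k n → Match (s xor t) i k n
  match-trans {s} {t = t} p q = matching λ {e} e<n →
    trans (at p e<n) (trans (cong (s xor_) (at q e<n)) (sym (xor-assoc s t _)))

  match-cancel : Match s i j n → Match s k j n → Agree i k n
  match-cancel {s} p q =
    subst (λ t → Match t _ _ _) (xor-same s) (match-trans p (match-sym q))

  match-take : m ≤ n → Match s i j n → Match s i j m
  match-take m≤n p = matching λ k<m → at p (<-≤-trans k<m m≤n)

  match-drop : ∀ e → Match s i j (e + n) → Match s (i + e) (j + e) n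
  match-drop {s} {i} {j} e p = matching λ {k} k<n →
    subst₂ (λ a b → v a ≡ s xor v b) (sym (+-assoc i e k)) (sym (+-assoc j e k))
      (at p (+-monoʳ-< e k<n))

  match-snoc : Match s i j n → v (i + n) ≡ s xor v (j + n) → Match s i j (suc n)
  match-snoc {s} {i} {j} {n} p eq = matching λ k<1+n → go (m≤n⇒m<n∨m≡n (s≤s⁻¹ k<1+n))
    where
    go : ∀ {k} → k < n ⊎ k ≡ n → v (i + k) ≡ s xor v (j + k)
    go (inj₁ k<n)  = at p k<n
    go (inj₂ refl) = eq

  -- Two occurrences witnessing that a factor of length n is right special.
  record Fork (i j n : ℕ) : Set where
    constructor fork
    field
      agree  : Agree i j n
      differ : v (i + n) ≢ v (j + n)

  open Fork

  fork-drop : ∀ e → Fork i j (e + n) → Fork (i + e) (j + e) n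
  fork-drop {i} {j} {n} e (fork a d) = fork (match-drop e a)
    (subst₂ (λ x y → v x ≢ v y) (sym (+-assoc i e n)) (sym (+-assoc j e n)) d)

  -- The extra letter in both matches carries the mismatch at `n` along; complementing both sides
  -- preserves agreement and difference.
  fork-transport : Match s k i (suc n) → Match s l j (suc n) → Fork i j n → Fork k l n
  fork-transport {s} {n = n} p q (fork a d) = fork
    (match-cancel (match-trans (match-take (n≤1+n n) p) a)
      (subst (λ t → Match t _ _ _) (sym (xor-identityʳ s)) (match-take (n≤1+n n) q)))
    λ eq → d (trans (xor-flip s (at p ≤-refl))
      (trans (cong (s xor_) eq) (sym (xor-flip s (at q ≤-refl)))))

  compare : ∀ i j n → Agree i j n ⊎ (∃ λ k → k < n × Fork i j k)
  compare i j zero = inj₁ (matching λ ())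
  compare i j (suc n) with compare i j n
  ... | inj₂ (k , k<n , f) = inj₂ (k , m<n⇒m<1+n k<n , f)
  ... | inj₁ a with v (i + n) ≟ᵇ v (j + n)
  ...   | yes eq = inj₁ (match-snoc a eq)
  ...   | no neq = inj₂ (n , ≤-refl , fork a neq)

  agree? : ∀ i j n → Dec (Agree i j n)
  agree? i j n with compare i j n
  ... | inj₁ a = yes a
  ... | inj₂ (k , k<n , fork _ d) = no λ a → d (at a k<n)

  -- Slices as words.

  length-slice : ∀ i n → length (slice v i n) ≡ n
  length-slice i zero    = refl
  length-slice i (suc n) = cong suc (length-slice (suc i) n)

  slice-map⇒ : ∀ (f : Bool → Bool) {i j} n → slice v i n ≡ map f (slice v j n) →
               ∀ {k} → k < n → v (i + k) ≡ f (v (j + k))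
  slice-map⇒ f {i} {j} (suc n) eq {zero} _
    rewrite +-identityʳ i | +-identityʳ j = proj₁ (∷-injective eq)
  slice-map⇒ f {i} {j} (suc n) eq {suc k} k<n
    rewrite +-suc i k | +-suc j k = slice-map⇒ f n (proj₂ (∷-injective eq)) (s<s⁻¹ k<n)

  slice⇒agree : slice v i n ≡ slice v j n → Agree i j n
  slice⇒agree {n = n} eq = matching (slice-map⇒ (λ b → b) n (trans eq (sym (map-id _))))

  agree⇒slice : Agree i j n → slice v i n ≡ slice v j n
  agree⇒slice {n = zero} _ = refl
  agree⇒slice {i} {j} {suc n} a = cong₂ _∷_ v₀ (agree⇒slice (matching λ {k} k<n →
      subst₂ (λ x y → v x ≡ v y) (+-suc i k) (+-suc j k) (at a (s<s k<n))))
    where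
    v₀ : v i ≡ v j
    v₀ = subst₂ (λ x y → v x ≡ v y) (+-identityʳ i) (+-identityʳ j) (at a z<s)

  slice-∷ʳ : ∀ i n → slice v i (suc n) ≡ slice v i n ∷ʳ v (i + n)
  slice-∷ʳ i zero    = cong (λ j → v j ∷ []) (sym (+-identityʳ i))
  slice-∷ʳ i (suc n) = cong (v i ∷_)
    (trans (slice-∷ʳ (suc i) n) (cong (λ j → slice v (suc i) n ∷ʳ v j) (sym (+-suc i n))))

  occursAt⇒agree : ∀ i → OccursAt v (slice v j n) i → Agree i j n
  occursAt⇒agree {j} {n} i eq = slice⇒agree (subst (λ m → slice v i m ≡ slice v j n) (length-slice j n) eq)

  agree⇒occursAt : Agree i j n → OccursAt v (slice v j n) i
  agree⇒occursAt {i} {j} {n} a =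
    subst (λ m → slice v i m ≡ slice v j n) (sym (length-slice j n)) (agree⇒slice a)

  slice-factor : ∀ i n → Factor v (slice v i n) × length (slice v i n) ≡ n
  slice-factor i n = (i , agree⇒occursAt match-refl) , length-slice i n

  factor-slice : ∀ {w} → Factor v w → length w ≡ n → ∃ λ i → w ≡ slice v i n
  factor-slice (i , eq) refl = i , sym eq

  -- Complexity, right special factors and periodicity.

  RightSpecial : ℕ → Word → Set
  RightSpecial n w = ∀ c → ∃ λ i → w ∷ʳ c ≡ slice v i (suc n)

  fork⇒rightSpecial : Fork i j n → RightSpecial n (slice v i n)
  fork⇒rightSpecial {i} {j} {n} (fork a d) c with c ≟ᵇ v (i + n)
  ... | yes refl = i , sym (slice-∷ʳ i n)
  ... | no neq   = j , sym (trans (slice-∷ʳ j n)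
          (cong₂ _∷ʳ_ (sym (agree⇒slice a)) (sym (≢-≢⇒≡ neq (d ∘ sym)))))

  -- A factor of length n has one right extension, a right special one has two.
  rightSpecial-count : ∀ {n c d R} → ComplexityIs v n c → ComplexityIs v (suc n) d →
                       Unique R → All (RightSpecial n) R → length R + c ≤ d
  rightSpecial-count {n} {R = R} (L , uL , refl , L⇔) (L′ , _ , refl , L′⇔) uR rs = begin
    length R + length L                         ≡⟨ cong₂ _+_ (length-map _ R) (length-map _ L) ⟨
    length (map (_∷ʳ false) R) + length (map g L) ≡⟨ length-++ (map (_∷ʳ false) R) ⟨
    length (map (_∷ʳ false) R ++ map g L)       ≤⟨ unique-⊆⇒length-≤ uniq sub ⟩
    length L′                                   ∎
    where
    open ≤-Reasoning
    -- `true` is preferred whenever it extends `w`, so `g` extends every word of `R` by `true`. The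
    -- extension by `false` is left to the other list, which makes the two disjoint.
    letter : Word → Bool
    letter w with (w ∷ʳ true) ∈? L′
    ... | yes _ = true
    ... | no _  = false
    g : Word → Word
    g w = w ∷ʳ letter w

    slice∈L′ : ∀ i → slice v i (suc n) ∈ L′
    slice∈L′ i = to (L′⇔ _) (slice-factor i (suc n))

    rs∈L′ : ∀ {w} → w ∈ R → ∀ c → w ∷ʳ c ∈ L′
    rs∈L′ w∈R c with All.lookup rs w∈R c
    ... | i , eq = subst (_∈ L′) (sym eq) (slice∈L′ i)

    letter-rs : ∀ {w} → w ∈ R → letter w ≡ true
    letter-rs {w} w∈R with (w ∷ʳ true) ∈? L′
    ... | yes _ = refl
    ... | no ∉  = contradiction (rs∈L′ w∈R true) ∉

    g∈L′ : ∀ {w} → w ∈ L → g w ∈ L′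
    g∈L′ {w} w∈L with from (L⇔ w) w∈L
    ... | fac , len with factor-slice fac len
    ...   | i , refl with (w ∷ʳ true) ∈? L′
    ...     | yes ∈ = ∈
    ...     | no ∉ with v (i + n) in eq
    ...       | false = subst (_∈ L′) (trans (slice-∷ʳ i n) (cong (w ∷ʳ_) eq)) (slice∈L′ i)
    ...       | true  = contradiction
                (subst (_∈ L′) (trans (slice-∷ʳ i n) (cong (w ∷ʳ_) eq)) (slice∈L′ i)) ∉

    uniq : Unique (map (_∷ʳ false) R ++ map g L)
    uniq = ++⁺ (map⁺ (λ {x} {y} eq → proj₁ (∷ʳ-injective x y eq)) uR)
               (map⁺ (λ {x} {y} eq → proj₁ (∷ʳ-injective x y eq)) uL) disjoint
      where
      disjoint : ∀ {x} → ¬ (x ∈ map (_∷ʳ false) R × x ∈ map g L)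
      disjoint (x∈ , x∈′) with ∈-map⁻ _ x∈ | ∈-map⁻ g x∈′
      ... | w , w∈R , refl | u , _ , eq with ∷ʳ-injective w u eq
      ...   | refl , eq′ = contradiction (trans eq′ (letter-rs w∈R)) λ ()

    sub : map (_∷ʳ false) R ++ map g L ⊆ L′
    sub x∈ with ∈-++⁻ (map (_∷ʳ false) R) x∈
    ... | inj₁ y∈ with ∈-map⁻ _ y∈
    ...   | w , w∈R , refl = rs∈L′ w∈R false
    sub x∈ | inj₂ y∈ with ∈-map⁻ g y∈
    ...   | w , w∈L , refl = g∈L′ w∈L

  -- Were v purely periodic with period d, it would have at most d factors of length d.
  not-periodic : ∀ d → 1 ≤ d → ComplexityIs v d (2 * d) → ∃ λ k → Fork 0 d k
  not-periodic d 1≤d (L , uL , len , L⇔) with ∀-⊎-distrib {xs = L} early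
    where
    -- While `d ≤ t`, agreement of `v` with its shift by `d` lets the start `t` be lowered by `d`.
    reduce : ∀ t → Agree 0 d t → ∃ λ r → r < d × Agree t r d
    reduce = <-rec _ λ t rec a → reduce-step t rec a
      where
      reduce-step : ∀ t → (∀ {u} → u < t → Agree 0 d u → ∃ λ r → r < d × Agree u r d) →
                    Agree 0 d t → ∃ λ r → r < d × Agree t r d
      reduce-step t rec a with t <? d
      ... | yes t<d = t , t<d , match-refl
      ... | no t≮d with m≤n⇒∃[o]m+o≡n (≮⇒≥ t≮d)
      ...   | u , refl with rec (m<n+m u 1≤d) (match-take (m≤n+m u d) a)
      ...     | r , r<d , b = r , r<d ,
                match-trans (match-sym (match-drop u (subst (Agree 0 d) (+-comm d u) a))) b
    early : ∀ {w} → w ∈ L → (∃ λ k → Fork 0 d k) ⊎ (w ∈ applyUpTo (λ r → slice v r d) d)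
    early w∈L with factor-slice (proj₁ (from (L⇔ _) w∈L)) (proj₂ (from (L⇔ _) w∈L))
    ... | t , refl with compare 0 d t
    ...   | inj₂ (k , _ , f) = inj₁ (k , f)
    ...   | inj₁ a with reduce t a
    ...     | r , r<d , b = inj₂ (subst (_∈ _) (sym (agree⇒slice b)) (∈-applyUpTo⁺ _ r<d))
  ... | inj₁ f = f
  ... | inj₂ all = contradiction (subst₂ _≤_ len (length-applyUpTo _ d)
          (unique-⊆⇒length-≤ uL (All.lookup all))) (<⇒≱ (m<m+n d (≤-trans 1≤d (m≤m+n d 0))))

  -- Right special factors and recurrence in Rote sequences.

  module _ (rote : IsCSRote v) where

    opposite : ∀ i n → ∃ λ j → Match true j i n
    opposite i n with proj₂ rote _ (proj₁ (slice-factor i n))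
    ... | j , eq = j , matching (slice-map⇒ not n
          (subst (λ m → slice v j m ≡ map not (slice v i n))
            (trans (length-map not (slice v i n)) (length-slice i n)) eq))

    opposite-≢ : 1 ≤ n → Match true i j n → slice v i n ≢ slice v j n
    opposite-≢ 1≤n o eq = not-¬ (at (slice⇒agree eq) 1≤n) (at o 1≤n)

    -- Complexity grows by two from `n` to `suc n`. The word at `k` and its complement are already
    -- two right special factors; a third would force growth by three.
    rightSpecial-fork-unique : 1 ≤ n → Fork i j n → Fork k l n → ∃ λ s → Match s i k n
    rightSpecial-fork-unique {n} {i} {j} {k} {l} 1≤n f g
      with opposite k (suc n) | opposite l (suc n)
    ... | k′ , ok | l′ , ol
      with ≡-dec _≟ᵇ_ (slice v i n) (slice v k n) | ≡-dec _≟ᵇ_ (slice v i n) (slice v k′ n)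
    ... | yes eq | _ = false , slice⇒agree eq
    ... | no _ | yes eq = true , match-trans (slice⇒agree eq) (match-take (n≤1+n n) ok)
    ... | no i≢k | no i≢k′ = contradiction
        (rightSpecial-count (proj₁ rote n 1≤n) (proj₁ rote (suc n) (s≤s z≤n))
          ((i≢k ∷ i≢k′ ∷ []) ∷ (opposite-≢ 1≤n (match-take (n≤1+n n) (match-sym ok)) ∷ []) ∷ [] ∷ [])
          (fork⇒rightSpecial f ∷ fork⇒rightSpecial g ∷ fork⇒rightSpecial (fork-transport ok ol g) ∷ []))
        (<⇒≱ (s≤s (≤-reflexive (*-suc 2 n))))

    -- Complementing twice: a prefix reaching up to an occurrence of the complement of
    -- prefix v n has a complemented copy, in which prefix v n itself occurs.
    prefix-returns : 1 ≤ n → ∃ λ i → 0 < i × Agree i 0 n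
    prefix-returns {n} 1≤n with opposite 0 n
    ... | j , oj with opposite 0 (j + n)
    ...   | k , ok = k + j , <-≤-trans k>0 (m≤m+n k j) ,
              match-trans (match-drop j ok) oj
      where
      k>0 : 0 < k
      -- At `k = 0` a non-empty prefix would be its own complement.
      k>0 = n≢0⇒n>0 λ { refl → opposite-≢ (≤-trans 1≤n (m≤n+m n j)) ok refl }

    -- Iterates `prefix-returns` on the longer prefix ending with the occurrence already found,
    -- whose return repeats that occurrence further right.
    prefix-recurrent : 1 ≤ n → ∀ N → ∃ λ i → N < i × Agree i 0 n
    prefix-recurrent 1≤n zero = prefix-returns 1≤n
    prefix-recurrent {n} 1≤n (suc N) with prefix-recurrent 1≤n N
    ... | i , N<i , a with prefix-returns (≤-trans 1≤n (m≤n+m n i))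
    ...   | j , 0<j , b = j + i , +-mono-≤ 0<j N<i , match-trans (match-drop i b) a

    -- Nodes of the tree of continuations.

    module _ (n : ℕ) (1≤n : 1 ≤ n) where

      Occ : ℕ → Set
      Occ i = Agree i 0 n

      -- Only occurrences that fit entirely into the `l` letters are excluded, so the condition
      -- depends on the word read, not on its position.
      FirstIn : ℕ → ℕ → Set
      FirstIn i l = ∀ {u} → 0 < u → u + n ≤ l → ¬ Occ (i + u)

      occ-shift : ∀ u → u + n ≤ l → Match s i j l → Occ (i + u) → Match s (j + u) 0 n
      occ-shift u le a o = subst (λ t → Match t _ _ _) (xor-identityʳ _)
          (match-trans (match-sym (match-drop u (match-take le a))) o)

      -- A branching point of the tree of the continuations of prefix v n up to its next occurrence.
      record Node (i j l : ℕ) : Set where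
        constructor node
        field
          forks  : Fork i j l
          n≤l    : n ≤ l
          occ    : Occ i
          firstIn : FirstIn i l

      open Node

      -- Both windows end at the same place. If `e < o`, the occurrence at `p + o` would lie inside
      -- the window starting at `p + e`, since `n ≤ l′` leaves room for it.
      ¬last-< : ∀ {p e o l l′} → e + l ≡ o + l′ → n ≤ l′ → Occ (p + o) → FirstIn (p + e) l → ¬ e < o
      ¬last-< {p} {e} {l = l} {l′} eq n≤l′ occ fst e<o with m≤n⇒∃[o]m+o≡n (<⇒≤ e<o)
      ... | u , refl = fst (+-cancelˡ-< e 0 u (subst (_< e + u) (sym (+-identityʳ e)) e<o))
          (subst (u + n ≤_) (+-cancelˡ-≡ e _ _ (trans (sym (+-assoc e u l′)) (sym eq))) (+-monoʳ-≤ u n≤l′))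
          (subst Occ (sym (+-assoc p e u)) occ)

      -- Suffixes of a right special word are right special; the cut is at the last occurrence of
      -- the prefix that fits into the `M` letters.
      node-in-fork : ∀ {p q M u} → Fork p q M → u + n ≤ M → Occ (p + u) →
                     ∃₂ λ o l → o + l ≡ M × Node (p + o) (q + o) l
      node-in-fork {p} {q} {M} {u} f u+n≤M occ with m≤n⇒∃[o]m+o≡n (≤-trans (m≤n+m n u) u+n≤M)
      ... | b , refl with last-below (λ k → agree? (p + k) 0 n) b
                            (+-cancelʳ-≤ n u b (subst (u + n ≤_) (+-comm n b) u+n≤M)) occ
      ...   | o , o≤b , occ′ , last with m≤n⇒∃[o]m+o≡n o≤b
      ...     | c , refl = o , c + n , eq ,
                  node (fork-drop o (subst (Fork p q) (sym eq) f)) (m≤n+m n c) occ′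
                    λ {u} 0<u le occ″ → last (m<m+n o 0<u) (+-monoʳ-≤ o (+-cancelʳ-≤ n u c le))
                      (subst Occ (+-assoc p o u) occ″)
        where
        eq : o + (c + n) ≡ n + (o + c)
        eq = trans (sym (+-assoc o c n)) (+-comm (o + c) n)

      -- Both nodes are suffixes of the word of length `M` at `p`, and each must begin at the last
      -- occurrence of the prefix in it.
      node-determined : ∀ {p q M o l i j e l′} → o + l ≡ M → Node (p + o) (q + o) l →
                        e + l′ ≡ M → Node i j l′ → Agree i (p + e) l′ →
                        l′ ≡ l × Agree i (p + o) l′
      node-determined {p} {o = o} {i = i} {e = e} {l′ = l′} eo N el N′ a with <-cmp e o
      ... | tri≈ _ refl _ = +-cancelˡ-≡ e _ _ (trans el (sym eo)) , a
      ... | tri< e<o _ _ = contradiction e<o (¬last-< (trans el (sym eo)) (n≤l N) (occ N)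
            λ {u} 0<u le oc → firstIn N′ 0<u le (occ-shift u le (match-sym a) oc))
      ... | tri> _ _ o<e = contradiction o<e (¬last-< (trans eo (sym el)) (n≤l N′)
            (match-trans (match-sym (match-take (n≤l N′) a)) (occ N′)) (firstIn N))

      occ-fork⇒n≤ : Occ i → Occ j → Fork i j k → n ≤ k
      occ-fork⇒n≤ oi oj f = ≮⇒≥ λ k<n → differ f (trans (at oi k<n) (sym (at oj k<n)))

      node-branch : Node i j l → Agree k i l → Fork k m l → Node k m l
      node-branch N a f = node f (n≤l N) (match-trans (match-take (n≤l N) a) (occ N))
        λ 0<u le oc → firstIn N 0<u le (occ-shift _ le a oc)

      -- The two branching points.

      record NodePair : Set where
        field
          start start′ len : Bool → ℕ
          nodes    : ∀ s → Node (start s) (start′ s) (len s)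
          classify : ∀ {i j l} → Node i j l → ∃ λ s → l ≡ len s × Agree i (start s) l
          len-<    : len false < len true

      module _ (P Q : Bool → ℕ) {M : ℕ} (forkPQ : ∀ s → Fork (P s) (Q s) M)
               (related : ∀ s → Match s (P s) (P false) M)
               {o len : Bool → ℕ} (o+len : ∀ s → o s + len s ≡ M)
               (nodes : ∀ s → Node (P s + o s) (Q s + o s) (len s)) where

        -- The length-`l` suffix of the long word at `P false` is right special, so the fork reads
        -- it or its complement, which is a suffix of the long word at `P true`.
        fork-aligned : ∀ {e} → 1 ≤ l → e + l ≡ M → Fork i j l → ∃ λ s → Agree i (P s + e) l
        fork-aligned {e = e} 1≤l refl f
          with rightSpecial-fork-unique 1≤l f (fork-drop e (forkPQ false))
        ... | s , m = s , match-cancel m (match-drop e (related s))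

        -- A node of length at most `M` is a suffix of one of the long words. A longer one would end
        -- with a long word, whose occurrence of the prefix would be a second one in the node.
        node-classify : Node i j l → ∃ λ s → l ≡ len s × Agree i (P s + o s) l
        node-classify {i} {j} {l} N with ≤-total l M
        node-classify {i} {j} {l} N | inj₁ l≤M with m≤n⇒∃[o]m+o≡n l≤M
        ... | e , eq with fork-aligned (≤-trans 1≤n (n≤l N)) (trans (+-comm e l) eq) (forks N)
        ...   | s , a = s , node-determined {q = Q s} (o+len s) (nodes s) (trans (+-comm e l) eq) N a
        node-classify {i} {j} {l} N | inj₂ M≤l with m≤n⇒∃[o]m+o≡n M≤l
        ... | e , refl with fork-aligned {e = 0} 1≤M refl
                              (fork-drop e (subst (Fork i j) (+-comm M e) (forks N)))
          where
          1≤M : 1 ≤ M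
          1≤M = ≤-trans 1≤n (≤-trans (n≤l (nodes false))
            (subst (len false ≤_) (o+len false) (m≤n+m _ _)))
        ...   | s , a with e + o s ≟ 0
        ...     | no e+o≢0 = contradiction
                  (subst Occ (+-assoc i e (o s))
                    (occ-shift (o s) o+n≤M (match-sym a)
                      (subst (λ p → Occ (p + o s)) (sym (+-identityʳ (P s))) (occ (nodes s)))))
                  (firstIn N (n≢0⇒n>0 e+o≢0)
                    (subst₂ _≤_ (sym (+-assoc e (o s) n)) (+-comm e M) (+-monoʳ-≤ e o+n≤M)))
          where
          o+n≤M : o s + n ≤ M
          o+n≤M = subst (o s + n ≤_) (o+len s) (+-monoʳ-≤ (o s) (n≤l (nodes s)))
        ...     | yes e+o≡0 with m+n≡0⇒m≡0 e e+o≡0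
        ...       | refl = s , node-determined {q = Q s} (o+len s) (nodes s) (+-identityʳ M) N
                    (subst₂ (λ x m → Agree x (P s + 0) m) (+-identityʳ i) (sym (+-identityʳ M)) a)

      -- The complement of `prefix v n` occurs at `j`, and the prefix reaching to its end returns at
      -- `d`. The first mismatch `M` of `v` with its shift by `d` is therefore at least `j + n`, so
      -- `prefix v M` and its complemented copy at `p` both contain `prefix v n`.
      node-pair : NodePair
      node-pair with opposite 0 n
      ... | j , oj with prefix-returns {j + n} (≤-trans 1≤n (m≤n+m n j))
      ... | d , 0<d , ad with not-periodic d 0<d (proj₁ rote d 0<d)
      ... | M , f with opposite 0 (suc M) | opposite d (suc M)
      ... | p , op | q , oq = result
        where
        j+n≤M : j + n ≤ M
        j+n≤M = ≮⇒≥ λ M<j+n → differ f (sym (at ad M<j+n))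

        n≤M : n ≤ M
        n≤M = ≤-trans (m≤n+m n j) j+n≤M

        P Q : Bool → ℕ
        P false = 0
        P true  = p
        Q false = d
        Q true  = q

        forkPQ : ∀ s → Fork (P s) (Q s) M
        forkPQ false = f
        forkPQ true  = fork-transport op oq f

        related : ∀ s → Match s (P s) 0 M
        related false = match-refl
        related true  = match-take (n≤1+n M) op

        suffixes : ∀ s → ∃₂ λ o l → o + l ≡ M × Node (P s + o) (Q s + o) l
        suffixes false = node-in-fork {u = 0} f n≤M match-refl
        suffixes true  = node-in-fork {u = j} (forkPQ true) j+n≤M
          (match-trans (match-drop j (match-take j+n≤M (related true))) oj)

        o len : Bool → ℕ
        o s   = proj₁ (suffixes s)
        len s = proj₁ (proj₂ (suffixes s))

        o+len : ∀ s → o s + len s ≡ M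
        o+len s = proj₁ (proj₂ (proj₂ (suffixes s)))

        nodes : ∀ s → Node (P s + o s) (Q s + o s) (len s)
        nodes s = proj₂ (proj₂ (proj₂ (suffixes s)))

        -- Equal lengths mean equal offsets, and at equal offsets the two long words read
        -- complementary letters, so they cannot both show the prefix there.
        len-≢ : len false ≢ len true
        len-≢ eq = opposite-≢ 1≤n
          (match-drop (o true) (match-take o+n≤M (related true)))
          (agree⇒slice (match-trans (occ (nodes true))
            (match-sym (subst Occ o-≡ (occ (nodes false))))))
          where
          o-≡ : o false ≡ o true
          o-≡ = +-cancelʳ-≡ (len true) _ _
            (trans (cong (o false +_) (sym eq)) (trans (o+len false) (sym (o+len true))))
          o+n≤M : o true + n ≤ M
          o+n≤M = subst (o true + n ≤_) (o+len true) (+-monoʳ-≤ (o true) (n≤l (nodes true)))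

        classify : ∀ {i j l} → Node i j l → ∃ λ s → l ≡ len s × Agree i (P s + o s) l
        classify = node-classify P Q forkPQ related o+len nodes

        result : NodePair
        result with <-cmp (len false) (len true)
        ... | tri< lt _ _ = record
          { start = λ s → P s + o s ; start′ = λ s → Q s + o s ; len = len
          ; nodes = nodes ; classify = classify ; len-< = lt }
        ... | tri≈ _ eq _ = contradiction eq len-≢
        ... | tri> _ _ gt = record
          { start = λ s → P (not s) + o (not s) ; start′ = λ s → Q (not s) + o (not s) ; len = len ∘ not
          ; nodes = nodes ∘ not ; classify = λ N → swap (classify N) ; len-< = gt }
          where
          swap : ∀ {i l} → (∃ λ s → l ≡ len s × Agree i (P s + o s) l) →
                 ∃ λ s → l ≡ len (not s) × Agree i (P (not s) + o (not s)) l
          swap (false , p) = true , p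
          swap (true  , p) = false , p

      -- Return words and where they diverge.

      record Return (i d : ℕ) : Set where
        constructor return
        field
          occ₁  : Occ i
          0<d   : 0 < d
          occ₂  : Occ (i + d)
          none  : ∀ {u} → 0 < u → u < d → ¬ Occ (i + u)

      open Return

      next-return : Occ i → ∃ λ d → Return i d
      next-return {i} oc with prefix-recurrent 1≤n i
      ... | j , i<j , oj with m≤n⇒∃[o]m+o≡n i<j
      ...   | e , refl with least (λ u → agree? (i + suc u) 0 n) e (subst Occ (sym (+-suc i e)) oj)
      ...     | d , od , first = suc d , return oc z<s od
                  λ { {suc u} _ u<d → first (s<s⁻¹ u<d) }

      -- The comparison covers `d + n` letters, a complete return word. Full agreement puts the next
      -- occurrence at the same offset; an earlier mismatch comes before the second occurrence is
      -- complete, hence at a node.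
      returns-diverge : ∀ {d d′} → Return i d → Return j d′ →
                        slice v i d ≡ slice v j d′ ⊎ (∃ λ k → Node i j k)
      returns-diverge {i} {j} {d} {d′} r r′ with compare i j (d + n)
      ... | inj₂ (k , k<d+n , f) = inj₂ (k , node f (occ-fork⇒n≤ (occ₁ r) (occ₁ r′) f) (occ₁ r)
              λ {u} 0<u le → none r 0<u (+-cancelʳ-< n u d (≤-<-trans le k<d+n)))
      ... | inj₁ a with <-cmp d d′
      ...   | tri< d<d′ _ _ = contradiction (occ-shift d ≤-refl a (occ₂ r)) (none r′ (0<d r) d<d′)
      ...   | tri≈ _ refl _ = inj₁ (agree⇒slice (match-take (m≤m+n d n) a))
      ...   | tri> _ _ d′<d = contradiction
              (occ-shift d′ (+-monoˡ-≤ n (<⇒≤ d′<d)) (match-sym a) (occ₂ r′)) (none r (0<d r′) d′<d)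

      -- If the return words were equal, the mismatch at `k` could lie neither in them nor in the
      -- occurrence of the prefix that follows; beyond it, the node would contain a second
      -- occurrence.
      node⇒returns-≢ : ∀ {d d′} → Return i d → Return j d′ → Node i j k → slice v i d ≢ slice v j d′
      node⇒returns-≢ {i} {j} {k} {d} {d′} r r′ N eq
        with trans (sym (length-slice i d)) (trans (cong length eq) (length-slice j d′))
      ... | refl with k <? d
      ...   | yes k<d = differ (forks N) (at (slice⇒agree eq) k<d)
      ...   | no k≮d with m≤n⇒∃[o]m+o≡n (≮⇒≥ k≮d)
      ...     | e , refl with e <? n
      ...       | no e≮n = firstIn N (0<d r) (+-monoʳ-≤ d (≮⇒≥ e≮n)) (occ₂ r)
      ...       | yes e<n = differ (forks N) (subst₂ (λ x y → v x ≡ v y) (+-assoc i d e) (+-assoc j d e)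
                    (trans (at (occ₂ r) e<n) (sym (at (occ₂ r′) e<n))))

      isReturnWord⇒return : ∀ {w} → IsReturnWord v (prefix v n) w → ∃₂ λ i d → Return i d × w ≡ slice v i d
      isReturnWord⇒return (i , j , i<j , oi , oj , between , eq) with m≤n⇒∃[o]m+o≡n (<⇒≤ i<j)
      ... | d , refl = i , d , return (occursAt⇒agree i oi)
            (+-cancelˡ-< i 0 d (subst (_< i + d) (sym (+-identityʳ i)) i<j))
            (occursAt⇒agree (i + d) oj)
            (λ {u} 0<u u<d oc → between (i + u) (m<m+n i 0<u) (+-monoʳ-< i u<d) (agree⇒occursAt oc)) ,
            trans eq (cong (slice v i) (m+n∸m≡n i d))

      return⇒isReturnWord : ∀ {d} → Return i d → IsReturnWord v (prefix v n) (slice v i d)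
      return⇒isReturnWord {i} {d} r =
        i , i + d , m<m+n i (0<d r) , agree⇒occursAt (occ₁ r) , agree⇒occursAt (occ₂ r) , between ,
        cong (slice v i) (sym (m+n∸m≡n i d))
        where
        between : ∀ k → i < k → k < i + d → ¬ OccursAt v (prefix v n) k
        between k i<k k<i+d oc with m≤n⇒∃[o]m+o≡n (<⇒≤ i<k)
        ... | u , refl = none r (+-cancelˡ-< i 0 u (subst (_< i + u) (sym (+-identityʳ i)) i<k))
              (+-cancelˡ-< i u d k<i+d) (occursAt⇒agree (i + u) oc)

      -- The three leaves.

      module _ (pair : NodePair) where

        open NodePair pair

        private
          s₁ t₁ l₁ s₂ t₂ l₂ : ℕ
          s₁ = start false
          t₁ = start′ false
          l₁ = len false
          s₂ = start true
          t₂ = start′ true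
          l₂ = len true

        node-len : Node i j k → k ≡ l₁ ⊎ k ≡ l₂
        node-len N with classify N
        ... | false , eq , _ = inj₁ eq
        ... | true  , eq , _ = inj₂ eq

        -- A mismatch before `l₁` would itself be a node, shorter than both existing ones.
        nodes-agree : Agree s₁ s₂ l₁
        nodes-agree with compare s₁ s₂ l₁
        ... | inj₁ a = a
        ... | inj₂ (k , k<l₁ , f) with node-len
                (node f (occ-fork⇒n≤ (occ (nodes false)) (occ (nodes true)) f) (occ (nodes false))
                  λ 0<u le → firstIn (nodes false) 0<u (≤-trans le (<⇒≤ k<l₁)))
        ...   | inj₁ refl = contradiction k<l₁ (<-irrefl refl)
        ...   | inj₂ refl = contradiction k<l₁ (<-asym len-<)

        -- Of the two continuations of the shorter node, the longer node follows one; `q` takes the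
        -- other.
        side-branch : ∃ λ q → Node q s₂ l₁
        side-branch with v (s₁ + l₁) ≟ᵇ v (s₂ + l₁)
        ... | no neq = s₁ , node-branch (nodes false) match-refl (fork nodes-agree neq)
        ... | yes eq = t₁ , node-branch (nodes false) (match-sym (agree (forks (nodes false))))
                (fork (match-trans (match-sym (agree (forks (nodes false)))) nodes-agree)
                  λ eq′ → differ (forks (nodes false)) (trans eq (sym eq′)))

        three-returns : ReturnWordCount v (prefix v n) 3
        three-returns with side-branch
        ... | q , N with next-return (occ N) | next-return (occ (nodes true))
                       | next-return (match-trans
                           (match-sym (match-take (n≤l (nodes true)) (agree (forks (nodes true)))))
                           (occ (nodes true)))
        ... | d₁ , r₁ | d₂ , r₂ | d₃ , r₃ =
          words ,
          (node⇒returns-≢ r₁ r₂ N ∷ node⇒returns-≢ r₁ r₃ N′ ∷ []) ∷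
            (node⇒returns-≢ r₂ r₃ (nodes true) ∷ []) ∷ [] ∷ [] ,
          refl , λ w → mk⇔ (complete w) (sound w)
          where
          words : List Word
          words = slice v q d₁ ∷ slice v s₂ d₂ ∷ slice v t₂ d₃ ∷ []

          s₂t₂ : Fork s₂ t₂ l₂
          s₂t₂ = forks (nodes true)

          -- As `l₁ < l₂`, the letter of `t₂` at `l₁` is still that of `s₂`.
          N′ : Node q t₂ l₁
          N′ = node-branch N match-refl
            (fork (match-trans (agree (forks N)) (match-take (<⇒≤ len-<) (agree s₂t₂)))
              λ eq → differ (forks N) (trans eq (sym (at (agree s₂t₂) len-<))))

          sound : ∀ w → w ∈ words → IsReturnWord v (prefix v n) w
          sound _ (here refl)                 = return⇒isReturnWord r₁
          sound _ (there (here refl))         = return⇒isReturnWord r₂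
          sound _ (there (there (here refl))) = return⇒isReturnWord r₃

          complete : ∀ w → IsReturnWord v (prefix v n) w → w ∈ words
          complete w rw with isReturnWord⇒return rw
          ... | i , d , r , refl with returns-diverge r₁ r
          ... | inj₁ eq = here (sym eq)
          ... | inj₂ (k , N₁) with classify N₁
          -- `q` has already left the path to the longer node at `l₁`.
          ... | true  , refl , a = contradiction (at a len-<) (differ (forks N))
          ... | false , refl , _ with returns-diverge r₂ r
          ... | inj₁ eq = there (here (sym eq))
          ... | inj₂ (k , N₂) with node-len N₂
          -- The letters at `l₁` after `q`, `s₂` and `i` would be pairwise distinct.
          ... | inj₁ refl = contradiction
                (≢-≢⇒≡ (differ (forks N) ∘ sym) (differ (forks N₁) ∘ sym)) (differ (forks N₂))
          ... | inj₂ refl with returns-diverge r₃ r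
          ... | inj₁ eq = there (there (here (sym eq)))
          ... | inj₂ (k , N₃) with node-len N₃
          -- At `l₁`, both `t₂` and `i` still follow `s₂`; at `l₂`, the next case, three letters
          -- would again be pairwise distinct.
          ... | inj₁ refl = contradiction
                (trans (sym (at (agree s₂t₂) len-<)) (at (agree (forks N₂)) len-<)) (differ (forks N₃))
          ... | inj₂ refl = contradiction
                (≢-≢⇒≡ (differ s₂t₂ ∘ sym) (differ (forks N₂) ∘ sym)) (differ (forks N₃))

theorem3p1 : (v : Seq) → IsCSRote v →
    (n : ℕ) → 1 ≤ n → ReturnWordCount v (prefix v n) 3
theorem3p1 v rote n 1≤n = three-returns v rote n 1≤n (node-pair v rote n 1≤n)
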